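{- (i) For all $m,n,p,q>0$: $(n\otimes\mathcal{T}_m,=)\models\psi^q_p$ if and only if either $p+1<m$, or $p+1=m$ and $q\le n$. (ii) For all $m,n,p,q>0$: $(n\otimes\mathcal{T}_m,=)\models\rho^q_p$ if and only if $p+1=m$ and $n=q$. (iii) For all $m,p,q>0$: $(\omega\otimes\mathcal{T}_m,=)\models\psi^q_p$ if and only if $p<m$.
   Context: Intuitionistic mathematics (constructive reading of logical constants; Markov's Principle not assumed), with Brouwer's Continuity Principle as an axiom (for every $R\subseteq\mathcal{N}\times\omega$, if $\forall\alpha\exists n[\alpha Rn]$ then $\forall\alpha\exists m\exists n\forall\beta[\overline{\alpha}m\sqsubset\beta\rightarrow\beta Rn]$). $\mathcal{N}=\omega^\omega$; $\langle i\rangle\ast\delta$ is the sequence with first value $i$ followed by $\delta$. $\mathcal{T}_m:=\{\alpha\mid\forall i[\alpha(i)\le\alpha(i+1)<m]\}$. For a set $\mathcal{F}\subseteq\mathcal{N}$ and $n\in\omega$: $n\otimes\mathcal{F}:=\{\langle i\rangle\ast\delta\mid i<n,\delta\in\mathcal{F}\}$ and $\omega\otimes\mathcal{F}:=\{\langle i\rangle\ast\delta\mid i\in\omega,\delta\in\mathcal{F}\}$. Formulas (language with only $=$): $D_0(\mathsf{x}):=\forall\mathsf{y}[\mathsf{x}=\mathsf{y}\vee\neg(\mathsf{x}=\mathsf{y})]$; for $m>0$, $D_m(\mathsf{x}):=\bigwedge_{i<m}\neg D_i(\mathsf{x})\wedge\forall\mathsf{y}[\bigwedge_{i<m}\neg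 D_i(\mathsf{y})\rightarrow(\mathsf{x}=\mathsf{y}\vee\neg(\mathsf{x}=\mathsf{y}))]$; $AP(\mathsf{x},\mathsf{y}):=\forall\mathsf{z}[\neg(\mathsf{z}=\mathsf{x})\vee\neg(\mathsf{z}=\mathsf{y})]$. For $p,q>0$: $\psi^q_p:=\exists\mathsf{x}_0\dots\exists\mathsf{x}_{q-1}[\bigwedge_{i<j<q}AP(\mathsf{x}_i,\mathsf{x}_j)\wedge\bigwedge_{i<q}\bigwedge_{j<p}\neg D_j(\mathsf{x}_i)]$ and $\rho^q_p:=\exists\mathsf{x}_0\dots\exists\mathsf{x}_{q-1}[\bigwedge_{i<j<q}AP(\mathsf{x}_i,\mathsf{x}_j)\wedge\bigwedge_{i<q}\bigwedge_{j<p}\neg D_j(\mathsf{x}_i)\wedge\forall\mathsf{z}[\bigwedge_{j<p}\neg D_j(\mathsf{z})\rightarrow\bigvee_{i<q}\mathsf{z}=\mathsf{x}_i]]$. Satisfaction is read intuitionistically with $=$ interpreted as equality of sequences. -}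

module Defs where

open import Data.Empty using () renaming (⊥ to Empty)
open import Data.Fin using (Fin; zero; suc; toℕ; inject; opposite)
open import Data.Nat using (ℕ; zero; suc; _≤_; _<_)
open import Data.Product using (Σ; _×_; proj₁)
open import Data.Sum using (_⊎_)
open import Data.Unit using () renaming (⊤ to Unit)
open import Data.Vec using (Vec; []; _∷_; lookup; tabulate)
open import Function using (_∘_)
open import Level using (0ℓ)
open import Relation.Binary.Bundles using (Setoid)
open import Relation.Binary.PropositionalEquality using (_≡_; _≗_; _→-setoid_)
open import Relation.Nullary.Irrelevant using (Irrelevant)
open import Relation.Unary using (Pred; _∈_)
import Relation.Binary.Construct.On as On

-- Propositional truncation, needed to read ∨ and ∃ intuitionistically.
-- With ∃ read as Σ, Brouwer's Continuity Principle is refutable in Martin-Löf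
-- type theory (Escardó and Xu, 2015), so a theorem assuming it would be
-- vacuous; with truncated ∃ it is consistent.  The truncation is unique up to
-- equivalence, and Agda without higher inductive types does not construct it,
-- hence the record.
record Truncation : Set₁ where
  field
    ∥_∥    : Set → Set
    ∣_∣    : ∀ {A : Set} → A → ∥ A ∥
    squash : ∀ {A : Set} → Irrelevant ∥ A ∥
    rec    : ∀ {A P : Set} → Irrelevant P → (A → P) → ∥ A ∥ → P

-- Formulas of the first-order language whose only relation symbol is =, with
-- free variables among n de Bruijn indices.
infix  8 _≐_
infixr 7 _∧_
infixr 6 _∨_
infixr 5 _⇒_

data Formula (n : ℕ) : Set where
  _≐_         : Fin n → Fin n → Formula n
  ⊤ ⊥         : Formula n
  _∧_ _∨_ _⇒_ : Formula n → Formula n → Formula n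
  all ex      : Formula (suc n) → Formula n

Sentence : Set
Sentence = Formula 0

infix 9 ~_

~_ : ∀ {n} → Formula n → Formula n
~ φ = φ ⇒ ⊥

⋀ : ∀ {n} (k : ℕ) → (Fin k → Formula n) → Formula n
⋀ zero    φ = ⊤
⋀ (suc k) φ = φ zero ∧ ⋀ k (φ ∘ suc)

⋁ : ∀ {n} (k : ℕ) → (Fin k → Formula n) → Formula n
⋁ zero    φ = ⊥
⋁ (suc k) φ = φ zero ∨ ⋁ k (φ ∘ suc)

-- NotD< m x is ⋀_{i<m} ¬ D_i(x).
D     : ∀ {n} → ℕ → Fin n → Formula n
NotD< : ∀ {n} → ℕ → Fin n → Formula n

D zero    x = all (suc x ≐ zero ∨ ~ (suc x ≐ zero))
D (suc m) x = NotD< (suc m) x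
            ∧ all (NotD< (suc m) zero ⇒ suc x ≐ zero ∨ ~ (suc x ≐ zero))

NotD< zero    x = ⊤
NotD< (suc m) x = NotD< m x ∧ ~ D m x

AP : ∀ {n} → Fin n → Fin n → Formula n
AP x y = all (~ (zero ≐ suc x) ∨ ~ (zero ≐ suc y))

-- ∃x₀ … ∃x_{q-1}.  As x₀ is bound outermost, the de Bruijn index of x_i in the
-- matrix is q - 1 - i, that is, opposite i.
exs : (q : ℕ) → Formula q → Sentence
exs zero    φ = φ
exs (suc q) φ = exs q (ex φ)

apartNotD : (q p : ℕ) → Formula q
apartNotD q p =
    ⋀ q (λ j → ⋀ (toℕ j) (λ i → AP (opposite (inject {i = j} i)) (opposite j)))
  ∧ ⋀ q (λ i → NotD< p (opposite i))

-- The superscript q is the first argument.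
ψ : (q p : ℕ) → Sentence
ψ q p = exs q (apartNotD q p)

ρ : (q p : ℕ) → Sentence
ρ q p = exs q (apartNotD q p
             ∧ all (NotD< p zero ⇒ ⋁ q (λ i → zero ≐ suc (opposite i))))

𝒩 : Set
𝒩 = ℕ → ℕ

infixr 5 _∗_

-- i ∗ δ is ⟨i⟩∗δ.
_∗_ : ℕ → 𝒩 → 𝒩
(i ∗ δ) zero    = i
(i ∗ δ) (suc k) = δ k

-- α ↾ m is the initial segment ᾱm.
_↾_ : 𝒩 → (m : ℕ) → Vec ℕ m
α ↾ m = tabulate (α ∘ toℕ)

_⊏_ : ∀ {m} → Vec ℕ m → 𝒩 → Set
_⊏_ {m} s β = β ↾ m ≡ s

𝒯 : ℕ → Pred 𝒩 0ℓ
𝒯 m α = ∀ i → α i ≤ α (suc i) × α (suc i) < m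

-- The structure (F, =), where = is pointwise equality of sequences.
⟨_,=⟩ : Pred 𝒩 0ℓ → Setoid 0ℓ 0ℓ
⟨ F ,=⟩ = On.setoid {B = Σ 𝒩 F} (ℕ →-setoid ℕ) proj₁

module Intuitionistic (T : Truncation) where

  open Truncation T public

  Exists : (A : Set) → (A → Set) → Set
  Exists A P = ∥ Σ A P ∥

  syntax Exists A (λ x → P) = ∃[ x ∈ A ] P

  infixr 1 _or_

  _or_ : Set → Set → Set
  P or Q = ∥ P ⊎ Q ∥

  -- A subset of 𝒩 × ω is a proposition-valued family that respects equality of
  -- sequences.
  ContinuityPrinciple : Set₁
  ContinuityPrinciple =
    (R : 𝒩 → ℕ → Set) →
    (∀ α n → Irrelevant (R α n)) →
    (∀ α β n → α ≗ β → R α n → R β n) →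
    (∀ α → ∃[ n ∈ ℕ ] R α n) →
    ∀ α → ∃[ m ∈ ℕ ] (∃[ n ∈ ℕ ] (∀ β → (α ↾ m) ⊏ β → R β n))

  infixr 6 _⊗_ ω⊗_

  _⊗_ : ℕ → Pred 𝒩 0ℓ → Pred 𝒩 0ℓ
  (n ⊗ F) α = ∃[ i ∈ ℕ ] (∃[ δ ∈ 𝒩 ] (i < n × δ ∈ F × α ≗ i ∗ δ))

  ω⊗_ : Pred 𝒩 0ℓ → Pred 𝒩 0ℓ
  (ω⊗ F) α = ∃[ i ∈ ℕ ] (∃[ δ ∈ 𝒩 ] (δ ∈ F × α ≗ i ∗ δ))

  module Satisfaction (M : Setoid 0ℓ 0ℓ) where
    open Setoid M

    ⟦_⟧ : ∀ {n} → Formula n → Vec Carrier n → Set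
    ⟦ x ≐ y ⟧ e = lookup e x ≈ lookup e y
    ⟦ ⊤ ⟧     e = Unit
    ⟦ ⊥ ⟧     e = Empty
    ⟦ φ ∧ χ ⟧ e = ⟦ φ ⟧ e × ⟦ χ ⟧ e
    ⟦ φ ∨ χ ⟧ e = ⟦ φ ⟧ e or ⟦ χ ⟧ e
    ⟦ φ ⇒ χ ⟧ e = ⟦ φ ⟧ e → ⟦ χ ⟧ e
    ⟦ all φ ⟧ e = (a : Carrier) → ⟦ φ ⟧ (a ∷ e)
    ⟦ ex φ ⟧  e = ∃[ a ∈ Carrier ] ⟦ φ ⟧ (a ∷ e)

  infix 4 _⊨_

  _⊨_ : Setoid 0ℓ 0ℓ → Sentence → Set
  M ⊨ φ = Satisfaction.⟦_⟧ M φ []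

{-# OPTIONS --safe #-}

-- For n ≤ ω, the formula ⋀_{j<p} ¬D_j defines n ⊗ 𝒯_{m-p} in n ⊗ 𝒯_m: a point of
-- 𝒯_{k+1} that reaches the top value k is determined by a finite initial segment
-- and hence isolated, whereas isolating a point that stays below k would decide
-- for every α whether α = 0 (add the partial sums of α to the point, capped at k),
-- which the Continuity Principle forbids.  The sentences ψ and ρ then count
-- apart elements of n ⊗ 𝒯_{m-p}: there are none if m ≤ p, exactly as many as
-- first values if m = p + 1, and infinitely many if m > p + 1.
module Submission where

open import Data.Empty using (⊥-elim)
open import Data.Fin using (Fin; zero; suc; toℕ; fromℕ<; inject; opposite)
open import Data.Fin.Properties using (toℕ-injective; toℕ<n; toℕ-fromℕ<; toℕ-inject; opposite-involutive; injective⇒≤)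
import Data.Fin.Properties as Fin
open import Data.Nat using (ℕ; zero; suc; _+_; _∸_; _⊓_; _≤_; _<_; _>_; z≤n; s≤s; _≤′_; ≤′-refl; ≤′-step; _≟_; _<?_)
open import Data.Nat.Properties
open import Data.Product using (Σ; _×_; _,_; proj₁; proj₂)
open import Data.Sum using (_⊎_; inj₁; inj₂)
import Data.Sum as Sum
open import Data.Unit using (tt) renaming (⊤ to Unit)
open import Data.Vec using (Vec; []; _∷_; lookup; tabulate)
open import Data.Vec.Properties using (lookup∘tabulate; tabulate-cong)
open import Function using (_∘_; const)
open import Function.Bundles using (_⇔_; mk⇔)
open import Level using (0ℓ)
open import Relation.Binary.Bundles using (Setoid)
open import Relation.Binary.Definitions using (tri<; tri≈; tri>)
open import Relation.Binary.PropositionalEquality using (_≡_; _≢_; _≗_; refl; sym; trans; cong; subst)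
open import Relation.Nullary using (¬_; yes; no)
open import Relation.Nullary.Decidable using (decidable-stable)
open import Relation.Unary using (Pred; _∈_)
open import Defs

-- Monotone sequences, partial sums and step sequences.

monotone : (f : ℕ → ℕ) → (∀ i → f i ≤ f (suc i)) → ∀ {i j} → i ≤ j → f i ≤ f j
monotone f mono = go ∘ ≤⇒≤′
  where
  go : ∀ {i j} → i ≤′ j → f i ≤ f j
  go ≤′-refl       = ≤-refl
  go (≤′-step i≤j) = ≤-trans (go i≤j) (mono _)

partialSum : 𝒩 → 𝒩
partialSum α zero    = α zero
partialSum α (suc k) = partialSum α k + α (suc k)

≤-partialSum : ∀ α k → α k ≤ partialSum α k
≤-partialSum α zero    = ≤-refl
≤-partialSum α (suc k) = m≤n+m _ _

partialSum-zero : ∀ α → α ≗ const 0 → partialSum α ≗ const 0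
partialSum-zero α α≗0 zero    = α≗0 zero
partialSum-zero α α≗0 (suc k)
  rewrite partialSum-zero α α≗0 k = α≗0 (suc k)

-- Truncated subtraction makes this a zeros followed by ones.
step : ℕ → 𝒩
step a k = 1 ∸ (a ∸ k)

step-< : ∀ {a k} → k < a → step a k ≡ 0
step-< k<a = m≤n⇒m∸n≡0 (m<n⇒0<n∸m k<a)

step-diag : ∀ a → step a a ≡ 1
step-diag a = cong (1 ∸_) (n∸n≡0 a)

step-≤1 : ∀ a k → step a k ≤ 1
step-≤1 a k = m∸n≤m 1 (a ∸ k)

step∈𝒯 : ∀ {m} → 1 < m → ∀ a → step a ∈ 𝒯 m
step∈𝒯 1<m a i = ∸-monoʳ-≤ 1 (∸-monoʳ-≤ a (n≤1+n i)) , ≤-<-trans (step-≤1 a (suc i)) 1<m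

zero∈𝒯 : ∀ {m} → 0 < m → const 0 ∈ 𝒯 m
zero∈𝒯 0<m _ = z≤n , 0<m

inject-surjective : ∀ {q} {i j : Fin q} → toℕ i < toℕ j → Σ (Fin (toℕ j)) λ k → inject {i = j} k ≡ i
inject-surjective i<j =
  fromℕ< i<j , toℕ-injective (trans (toℕ-inject (fromℕ< i<j)) (toℕ-fromℕ< i<j))

opposite-injective : ∀ {q} {i j : Fin q} → opposite i ≡ opposite j → i ≡ j
opposite-injective {i = i} {j} eq =
  trans (sym (opposite-involutive i)) (trans (cong opposite eq) (opposite-involutive j))

-- Truncated choice and the consequence of continuity.

module _ (T : Truncation) where
  open Intuitionistic T

  ∥∥-map : ∀ {A B : Set} → (A → B) → ∥ A ∥ → ∥ B ∥
  ∥∥-map f = rec squash (∣_∣ ∘ f)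

  finiteChoice : ∀ k {A : Fin k → Set} → (∀ i → ∥ A i ∥) → ∥ (∀ i → A i) ∥
  finiteChoice zero    as = ∣ (λ ()) ∣
  finiteChoice (suc k) as =
    rec squash (λ a → ∥∥-map (λ as′ → λ { zero → a ; (suc i) → as′ i }) (finiteChoice k (as ∘ suc))) (as zero)

  -- The conclusion is the negation of WLPO.
  zero-undecidable : ContinuityPrinciple → ¬ (∀ α → α ≗ const 0 or ¬ α ≗ const 0)
  zero-undecidable cp wlpo =
    rec (λ ()) (λ (m , h) → rec (λ ()) (λ (n , h) → absurd m n h) h)
      (cp R (λ _ _ → squash) (λ α β n eq → ∥∥-map (resp α β n eq)) total (const 0))
    where
    Q : 𝒩 → ℕ → Set
    Q α zero    = α ≗ const 0
    Q α (suc _) = ¬ α ≗ const 0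

    -- The answers are coded by `0` for yes and any positive number for no; truncation makes the
    -- relation proposition-valued, as continuity demands.
    R : 𝒩 → ℕ → Set
    R α n = ∥ Q α n ∥

    resp : ∀ α β n → α ≗ β → Q α n → Q β n
    resp α β zero    eq α≗0 i   = trans (sym (eq i)) (α≗0 i)
    resp α β (suc n) eq α≇0 β≗0 = α≇0 λ i → trans (eq i) (β≗0 i)

    total : ∀ α → ∃[ n ∈ ℕ ] R α n
    total α = ∥∥-map (λ { (inj₁ α≗0) → 0 , ∣ α≗0 ∣ ; (inj₂ α≇0) → 1 , ∣ α≇0 ∣ }) (wlpo α)

    absurd : ∀ m n → ¬ (∀ β → (const 0 ↾ m) ⊏ β → R β n)
    -- The answer yes at `const 0` would extend to `step m`, which agrees with it below `m` but
    -- takes the value 1 at `m`. The answer no is already false at `const 0` itself.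
    absurd m zero h =
      rec (λ ()) (λ eq → 1+n≢0 (trans (sym (step-diag m)) (eq m)))
        (h (step m) (tabulate-cong λ i → step-< (toℕ<n i)))
    absurd m (suc n) h = rec (λ ()) (λ ≇0 → ≇0 λ _ → refl) (h (const 0) refl)

  -- Satisfaction of iterated connectives and quantifiers.

  module _ (M : Setoid 0ℓ 0ℓ) where
    open Setoid M using (Carrier)
    open Satisfaction M

    exs-elim : ∀ q {φ} → ⟦ exs q φ ⟧ [] → ∃[ e ∈ Vec Carrier q ] ⟦ φ ⟧ e
    exs-elim zero    h = ∣ [] , h ∣
    exs-elim (suc q) h =
      rec squash (λ (e , h) → ∥∥-map (λ (a , h) → a ∷ e , h) h) (exs-elim q h)

    exs-intro : ∀ q {φ} (e : Vec Carrier q) → ⟦ φ ⟧ e → ⟦ exs q φ ⟧ []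
    exs-intro zero    []      h = h
    exs-intro (suc q) (a ∷ e) h = exs-intro q e ∣ a , h ∣

    ⋀-elim : ∀ {n} k {φ : Fin k → Formula n} {e} → ⟦ ⋀ k φ ⟧ e → ∀ i → ⟦ φ i ⟧ e
    ⋀-elim (suc k) (h , hs) zero    = h
    ⋀-elim (suc k) (h , hs) (suc i) = ⋀-elim k hs i

    ⋀-intro : ∀ {n} k {φ : Fin k → Formula n} {e} → (∀ i → ⟦ φ i ⟧ e) → ⟦ ⋀ k φ ⟧ e
    ⋀-intro zero    h = tt
    ⋀-intro (suc k) h = h zero , ⋀-intro k (h ∘ suc)

    ⋁-elim : ∀ {n} k {φ : Fin k → Formula n} {e} → ⟦ ⋁ k φ ⟧ e → ∃[ i ∈ Fin k ] ⟦ φ i ⟧ e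
    ⋁-elim (suc k) = rec squash λ
      { (inj₁ h) → ∣ zero , h ∣
      ; (inj₂ h) → ∥∥-map (λ (i , h) → suc i , h) (⋁-elim k h) }

    ⋁-intro : ∀ {n} k {φ : Fin k → Formula n} {e} i → ⟦ φ i ⟧ e → ⟦ ⋁ k φ ⟧ e
    ⋁-intro (suc k) zero    h = ∣ inj₁ h ∣
    ⋁-intro (suc k) (suc i) h = ∣ inj₂ (⋁-intro k i h) ∣

    -- Only `D (suc p)` carries a guard on its quantifier. Since `NotD< 0` is `⊤`, both cases can be
    -- given the guarded form, which is the one that suits induction on `p`.
    D-elim : ∀ {n} p {x : Fin n} {e} → ⟦ D p x ⟧ e → ∀ a → ⟦ NotD< p zero ⟧ (a ∷ e) →
             ⟦ suc x ≐ zero ∨ ~ (suc x ≐ zero) ⟧ (a ∷ e)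
    D-elim zero    h a _ = h a
    D-elim (suc p) h     = proj₂ h

    D-intro : ∀ {n} p {x : Fin n} {e} → ⟦ NotD< p x ⟧ e →
              (∀ a → ⟦ NotD< p zero ⟧ (a ∷ e) → ⟦ suc x ≐ zero ∨ ~ (suc x ≐ zero) ⟧ (a ∷ e)) →
              ⟦ D p x ⟧ e
    D-intro zero    _ h a = h a tt
    D-intro (suc p) n h   = n , h

  -- The common form of the structures.

  -- F = {⟨i⟩∗δ | i ∈ P, δ ∈ 𝒯_m}, covering both n ⊗ 𝒯 m and ω⊗ 𝒯 m.
  record Prefixed (P : ℕ → Set) (m : ℕ) (F : Pred 𝒩 0ℓ) : Set where
    field
      head : ∀ {α} → F α → P (α 0)
      tail : ∀ {α} → F α → (α ∘ suc) ∈ 𝒯 m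
      cons : ∀ {i δ} → P i → δ ∈ 𝒯 m → F (i ∗ δ)

  𝒯-respects : ∀ {m i α δ} → δ ∈ 𝒯 m → α ≗ i ∗ δ → (α ∘ suc) ∈ 𝒯 m
  𝒯-respects δ∈ eq k rewrite eq (suc k) | eq (suc (suc k)) = δ∈ k

  -- Allows the truncated witnesses of membership to be eliminated one index at a time, so no
  -- function extensionality is involved.
  𝒯-irrelevant : ∀ {m i} {α : 𝒩} (p q : α i ≤ α (suc i) × α (suc i) < m) → p ≡ q
  𝒯-irrelevant (a , b) (c , d) rewrite ≤-irrelevant a c | ≤-irrelevant b d = refl

  ⊗-prefixed : ∀ n m → Prefixed (_< n) m (n ⊗ 𝒯 m)
  ⊗-prefixed n m = record
    { head = rec <-irrelevant λ (i , h) → rec <-irrelevant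
        (λ (δ , i<n , _ , eq) → subst (_< n) (sym (eq 0)) i<n) h
    ; tail = λ {α} α∈ k → rec (𝒯-irrelevant {α = α ∘ suc}) (λ (i , h) → rec (𝒯-irrelevant {α = α ∘ suc})
        (λ (δ , _ , δ∈ , eq) → 𝒯-respects δ∈ eq k) h) α∈
    ; cons = λ i<n δ∈ → ∣ _ , ∣ _ , i<n , δ∈ , (λ _ → refl) ∣ ∣
    }

  ω⊗-prefixed : ∀ m → Prefixed (const Unit) m (ω⊗ 𝒯 m)
  ω⊗-prefixed m = record
    { head = λ _ → tt
    ; tail = λ {α} α∈ k → rec (𝒯-irrelevant {α = α ∘ suc}) (λ (i , h) → rec (𝒯-irrelevant {α = α ∘ suc})
        (λ (δ , δ∈ , eq) → 𝒯-respects δ∈ eq k) h) α∈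
    ; cons = λ _ δ∈ → ∣ _ , ∣ _ , δ∈ , (λ _ → refl) ∣ ∣
    }

  -- The sets defined by `NotD<`.

  module Counting (cp : ContinuityPrinciple) {P : ℕ → Set} {m : ℕ} {F : Pred 𝒩 0ℓ}
                  (prefixed : Prefixed P m F) where
    open Prefixed prefixed
    open Satisfaction ⟨ F ,=⟩

    Carrier : Set
    Carrier = Σ 𝒩 F

    _≈_ : Carrier → Carrier → Set
    x ≈ y = proj₁ x ≗ proj₁ y

    -- For a point of `F` this says that its tail lies in 𝒯_{m-p}; the additive form avoids
    -- truncated subtraction.
    Below : ℕ → Carrier → Set
    Below p x = ∀ i → p + proj₁ x (suc i) < m

    -- The value at `suc i` is the largest that `Below p` allows, and the tail is monotone, so it
    -- can never change again.
    saturated : ∀ {p i} (x : Carrier) → Below p x → suc (p + proj₁ x (suc i)) ≡ m →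
                ∀ {k} → i ≤ k → proj₁ x (suc k) ≡ proj₁ x (suc i)
    saturated {p} (α , α∈) below top {k} i≤k = ≤-antisym
      (+-cancelˡ-≤ p _ _ (≤-pred (subst (p + α (suc k) <_) (sym top) (below k))))
      (monotone (α ∘ suc) (proj₁ ∘ tail α∈) i≤k)

    topped-isolated : ∀ {p i} (x a : Carrier) → Below p x → Below p a →
                      suc (p + proj₁ x (suc i)) ≡ m → x ≈ a or ¬ x ≈ a
    topped-isolated {p} {i} x@(α , _) a@(β , _) bx ba top
      -- The bound covers the head and the tail entries up to and including `i`, so agreement shows
      -- that `β` reaches the top as well and both are constant from there on.
      with allUpTo? (λ k → α k ≟ β k) (suc (suc i))
    ... | no differ = ∣ inj₂ (λ eq → differ λ {k} _ → eq k) ∣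
    ... | yes agree = ∣ inj₁ same ∣
      where
      topβ : suc (p + β (suc i)) ≡ m
      topβ = subst (λ v → suc (p + v) ≡ m) (agree ≤-refl) top

      same : α ≗ β
      same zero = agree (s≤s z≤n)
      same (suc k) with ≤-total k i
      ... | inj₁ k≤i = agree (s≤s (s≤s k≤i))
      ... | inj₂ i≤k = trans (saturated x bx top i≤k) (trans (agree ≤-refl) (sym (saturated a ba topβ i≤k)))

    below-not-isolated : ∀ p (x : Carrier) → Below (suc p) x → ¬ (∀ a → Below p a → x ≈ a or ¬ x ≈ a)
    below-not-isolated p (α , α∈) below isolated = zero-undecidable cp λ γ →
      ∥∥-map (Sum.map (≈⇒zero γ) (λ ≉ γ≗0 → ≉ (zero⇒≈ γ γ≗0))) (isolated (raised γ) (raised-below γ))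
      where
      δ : 𝒩
      δ = α ∘ suc

      -- The largest tail value that `Below p` permits; `Below (suc p)` keeps `δ` strictly under it.
      t : ℕ
      t = m ∸ suc p

      p<m : suc p ≤ m
      p<m = ≤-trans (m≤m+n (suc p) (δ 0)) (<⇒≤ (below 0))

      p+t<m : p + t < m
      p+t<m = ≤-reflexive (m+[n∸m]≡n p<m)

      δ<t : ∀ k → δ k < t
      δ<t k = +-cancelˡ-< (suc p) _ _ (subst (suc p + δ k <_) (sym (m+[n∸m]≡n p<m)) (below k))

      ε : 𝒩 → 𝒩
      -- Adding partial sums rather than `γ` itself keeps the tail monotone, and they vanish only if
      -- `γ` does.
      ε γ k = t ⊓ (δ k + partialSum γ k)

      ε∈𝒯 : ∀ γ → ε γ ∈ 𝒯 m
      ε∈𝒯 γ k =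
        ⊓-mono-≤ ≤-refl (+-mono-≤ (proj₁ (tail α∈ k)) (m≤m+n _ _)) ,
        ≤-<-trans (≤-trans (m⊓n≤m t _) (m≤n+m t p)) p+t<m

      raised : 𝒩 → Carrier
      raised γ = α 0 ∗ ε γ , cons (head α∈) (ε∈𝒯 γ)

      raised-below : ∀ γ → Below p (raised γ)
      raised-below γ k = ≤-<-trans (+-monoʳ-≤ p (m⊓n≤m t _)) p+t<m

      ≈⇒zero : ∀ γ → α ≗ α 0 ∗ ε γ → γ ≗ const 0
      ≈⇒zero γ eq k with ⊓-sel t (δ k + partialSum γ k)
      -- `δ` never attains the cap, so equality rules out the capped case; in the other case
      -- cancelling `δ k` leaves a zero partial sum.
      ... | inj₁ ≡t = ⊥-elim (<⇒≢ (δ<t k) (trans (eq (suc k)) ≡t))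
      ... | inj₂ ≡+ = n≤0⇒n≡0 (≤-trans (≤-partialSum γ k)
        (≤-reflexive (+-cancelˡ-≡ (δ k) _ _
          (trans (sym (trans (eq (suc k)) ≡+)) (sym (+-identityʳ (δ k)))))))

      zero⇒≈ : ∀ γ → γ ≗ const 0 → α ≗ α 0 ∗ ε γ
      zero⇒≈ γ γ≗0 zero = refl
      zero⇒≈ γ γ≗0 (suc k) rewrite partialSum-zero γ γ≗0 k | +-identityʳ (δ k) =
        sym (m≥n⇒m⊓n≡n (<⇒≤ (δ<t k)))

    -- By induction on `p`, the guard in `D p` restricts its quantifier to the points satisfying
    -- `Below p`. Among these, a point reaching the top is isolated and one staying under it is not,
    -- so excluding `D p` lowers the bound by one.
    NotD<⇒Below : ∀ {n} p {x : Fin n} {e} → ⟦ NotD< p x ⟧ e → Below p (lookup e x)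
    Below⇒NotD< : ∀ {n} p {x : Fin n} {e} → Below p (lookup e x) → ⟦ NotD< p x ⟧ e

    NotD<⇒Below zero {x} {e} _ i =
      let below = tail (proj₂ (lookup e x)) i in ≤-<-trans (proj₁ below) (proj₂ below)
    NotD<⇒Below (suc p) {x} {e} (notD< , ¬D) i =
      -- The order on ℕ is stable, so it suffices to refute the opposite: a value not under the new
      -- bound would be the top one and make `D p` true.
      decidable-stable (_ <? m) λ ≮m → ¬D (D-intro _ p notD< λ a a-notD< →
        topped-isolated (lookup e x) a (NotD<⇒Below p notD<) (NotD<⇒Below p a-notD<)
          (≤-antisym (NotD<⇒Below p notD< i) (≮⇒≥ ≮m)))

    Below⇒NotD< zero    _ = tt
    Below⇒NotD< (suc p) {x} {e} below =
      Below⇒NotD< p (λ i → <-trans (n<1+n _) (below i)) ,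
      λ d → below-not-isolated p (lookup e x) below
        λ a a-below → D-elim _ p d a (Below⇒NotD< p a-below)

    -- Apartness and counting.

    Distinct : ∀ {q} → (Fin q → Carrier) → Set
    Distinct g = ∀ {i j} → g i ≈ g j → i ≡ j

    Apart : Carrier → Carrier → Set
    Apart x y = ∀ z → ¬ z ≈ x or ¬ z ≈ y

    apart⇒≉ : ∀ x y → Apart x y → ¬ x ≈ y
    apart⇒≉ x y ap x≈y =
      rec (λ ()) (λ { (inj₁ ≉) → ≉ (λ _ → refl) ; (inj₂ ≉) → ≉ x≈y }) (ap x)

    -- Equality of numbers is decidable, and `z` cannot agree with both sequences at `k`.
    differ⇒apart : ∀ x y k → proj₁ x k ≢ proj₁ y k → Apart x y
    differ⇒apart x y k x≢y z with proj₁ z k ≟ proj₁ x k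
    ... | yes z≡x = ∣ inj₂ (λ z≈y → x≢y (trans (sym z≡x) (z≈y k))) ∣
    ... | no  z≢x = ∣ inj₁ (λ z≈x → z≢x (z≈x k)) ∣

    PairwiseApart : ∀ {q} → (Fin q → Carrier) → Set
    PairwiseApart g = ∀ {i j} → i ≢ j → Apart (g i) (g j)

    apart⇒distinct : ∀ {q} (g : Fin q → Carrier) → PairwiseApart g → Distinct g
    apart⇒distinct g aps {i} {j} eq =
      decidable-stable (i Fin.≟ j) λ i≢j → apart⇒≉ (g i) (g j) (aps i≢j) eq

    apartNotD-elim : ∀ q p {e} → ⟦ apartNotD q p ⟧ e →
                     Distinct (lookup e ∘ opposite) × (∀ i → Below p (lookup e (opposite i)))
    apartNotD-elim q p {e} (aps , nds) = distinct , λ i → NotD<⇒Below p (⋀-elim _ q nds i)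
      where
      <⇒≉ : ∀ {i j} → toℕ i < toℕ j → ¬ lookup e (opposite i) ≈ lookup e (opposite j)
      <⇒≉ {i} {j} i<j with k , refl ← inject-surjective {i = i} {j} i<j =
        apart⇒≉ (lookup e (opposite (inject {i = j} k))) (lookup e (opposite j))
          (⋀-elim _ (toℕ j) (⋀-elim _ q aps j) k)

      distinct : Distinct (lookup e ∘ opposite)
      -- The formula lists only the pairs with `i` before `j`; symmetry of `≈` supplies the others.
      distinct {i} {j} eq with <-cmp (toℕ i) (toℕ j)
      ... | tri< i<j _ _ = ⊥-elim (<⇒≉ i<j eq)
      ... | tri≈ _ i≡j _ = toℕ-injective i≡j
      ... | tri> _ _ j<i = ⊥-elim (<⇒≉ j<i (sym ∘ eq))

    apartNotD-intro : ∀ q p (g : Fin q → Carrier) → PairwiseApart g → (∀ i → Below p (g i)) →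
                      ⟦ apartNotD q p ⟧ (tabulate g)
    apartNotD-intro q p g aps below =
      ⋀-intro _ q (λ j → ⋀-intro _ (toℕ j) λ i → ap (i≢j j i)) ,
      ⋀-intro _ q (λ i → Below⇒NotD< p (subst (Below p) (sym (lookup∘tabulate g (opposite i))) (below (opposite i))))
      where
      ap : ∀ {i j} → i ≢ j → Apart (lookup (tabulate g) i) (lookup (tabulate g) j)
      ap {i} {j} i≢j rewrite lookup∘tabulate g i | lookup∘tabulate g j = aps i≢j

      i≢j : ∀ j i → opposite (inject {i = j} i) ≢ opposite j
      i≢j j i eq = <⇒≢ (toℕ<n i) (trans (sym (toℕ-inject i)) (cong toℕ (opposite-injective eq)))

    ψ-intro : ∀ q p (g : Fin q → Carrier) → PairwiseApart g → (∀ i → Below p (g i)) → ⟦ ψ q p ⟧ []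
    ψ-intro q p g aps below = exs-intro _ q (tabulate g) (apartNotD-intro q p g aps below)

    -- As `q` is positive there is a point at level `p`, and its first tail entry already witnesses
    -- the inequality.
    nonempty⇒p<m : ∀ {q p e} → q > 0 → ⟦ apartNotD q p ⟧ e → p < m
    nonempty⇒p<m {suc q} {p} _ h = ≤-<-trans (m≤m+n p _) (proj₂ (apartNotD-elim _ p h) zero 0)

    -- At the last nonempty level only the tail value 0 remains, so a point is determined by its
    -- head.
    Below-top⇒zero : ∀ {p} → suc p ≡ m → (x : Carrier) → Below p x → ∀ k → proj₁ x (suc k) ≡ 0
    Below-top⇒zero {p} top x below k = n≤0⇒n≡0 (+-cancelˡ-≤ p _ _
      (≤-trans (≤-pred (subst (_ <_) (sym top) (below k))) (≤-reflexive (sym (+-identityʳ p)))))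

    -- Pigeonhole: each `g i` equals one of the `q` listed points, which gives an injection of
    -- indices. The disjunctions are truncated, so `finiteChoice` is needed to obtain all these
    -- indices together.
    covered⇒≤ : ∀ q p {e k} (g : Fin k → Carrier) → Distinct g → (∀ i → Below p (g i)) →
                ⟦ all (NotD< p zero ⇒ ⋁ q (λ i → zero ≐ suc (opposite i))) ⟧ e → k ≤ q
    covered⇒≤ q p {e} {k} g distinct below cover =
      rec ≤-irrelevant
        (λ h → injective⇒≤ {f = proj₁ ∘ h} λ {i} {j} eq → distinct λ l →
          trans (proj₂ (h i) l) (trans (cong (λ i → proj₁ (lookup e (opposite i)) l) eq) (sym (proj₂ (h j) l))))
        (finiteChoice k λ i → ⋁-elim _ q {e = g i ∷ e} (cover (g i) (Below⇒NotD< p (below i))))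

    -- Explicit families of apart points.

    module Constants (m>0 : m > 0) {q} (ps : (i : Fin q) → P (toℕ i)) where

      constants : Fin q → Carrier
      constants i = toℕ i ∗ const 0 , cons (ps i) (zero∈𝒯 m>0)

      constants-apart : PairwiseApart constants
      constants-apart i≢j = differ⇒apart (constants _) (constants _) 0 (i≢j ∘ toℕ-injective)

      constants-below : ∀ {p} → p < m → ∀ i → Below p (constants i)
      constants-below {p} p<m _ _ = subst (_< m) (sym (+-identityʳ p)) p<m

    module Steps {p} (p+1<m : suc p < m) (P0 : P 0) (q : ℕ) where

      -- With a spare tail value, a single head carries arbitrarily many apart points, told apart by
      -- the place of the jump from 0 to 1.
      steps : Fin q → Carrier
      steps i = 0 ∗ step (toℕ i) , cons P0 (step∈𝒯 (≤-<-trans (s≤s z≤n) p+1<m) (toℕ i))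

      steps-apart : PairwiseApart steps
      steps-apart {i} {j} i≢j with <-cmp (toℕ i) (toℕ j)
      ... | tri≈ _ i≡j _ = ⊥-elim (i≢j (toℕ-injective i≡j))
      ... | tri< i<j _ _ = differ⇒apart (steps i) (steps j) (suc (toℕ i))
        λ eq → 1+n≢0 (trans (sym (step-diag (toℕ i))) (trans eq (step-< i<j)))
      ... | tri> _ _ j<i = differ⇒apart (steps i) (steps j) (suc (toℕ j))
        λ eq → 1+n≢0 (trans (sym (step-diag (toℕ j))) (trans (sym eq) (step-< j<i)))

      steps-below : ∀ i → Below p (steps i)
      steps-below i k =
        ≤-<-trans (+-monoʳ-≤ p (step-≤1 (toℕ i) k)) (subst (_< m) (+-comm 1 p) p+1<m)

  -- The equivalences for finitely many and for all heads.

  module _ (cp : ContinuityPrinciple) (m n p q : ℕ) (m>0 : m > 0) (n>0 : n > 0) (q>0 : q > 0) where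
    open Counting cp (⊗-prefixed n m)
    open Prefixed (⊗-prefixed n m)
    open Satisfaction ⟨ n ⊗ 𝒯 m ,=⟩

    -- Points of the last level differ only in their heads, so taking heads is an injection into
    -- `Fin n`.
    apartNotD⇒q≤n : suc p ≡ m → ∀ {e} → ⟦ apartNotD q p ⟧ e → q ≤ n
    apartNotD⇒q≤n top {e} h with distinct , below ← apartNotD-elim q p h =
      injective⇒≤ {f = λ i → fromℕ< (head (proj₂ (x i)))} λ {i} {j} eq → distinct λ
        { zero    → trans (sym (toℕ-fromℕ< _)) (trans (cong toℕ eq) (toℕ-fromℕ< _))
        ; (suc k) → trans (Below-top⇒zero top (x i) (below i) k) (sym (Below-top⇒zero top (x j) (below j) k)) }
      where
      x : Fin q → Carrier
      x i = lookup e (opposite i)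

    ⊗⊨ψ⇔ : ⟨ n ⊗ 𝒯 m ,=⟩ ⊨ ψ q p ⇔ (suc p < m ⊎ (suc p ≡ m × q ≤ n))
    ⊗⊨ψ⇔ = mk⇔ to from
      where
      to : ⟨ n ⊗ 𝒯 m ,=⟩ ⊨ ψ q p → suc p < m ⊎ (suc p ≡ m × q ≤ n)
      to h = Sum.map₂ (λ top → top , rec ≤-irrelevant (λ (e , h) → apartNotD⇒q≤n top h) (exs-elim _ q h))
        (m≤n⇒m<n∨m≡n (rec <-irrelevant (λ (e , h) → nonempty⇒p<m {q} {p} {e} q>0 h) (exs-elim _ q h)))

      from : suc p < m ⊎ (suc p ≡ m × q ≤ n) → ⟨ n ⊗ 𝒯 m ,=⟩ ⊨ ψ q p
      from (inj₁ p+1<m) = ψ-intro q p steps steps-apart steps-below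
        where open Steps p+1<m n>0 q
      from (inj₂ (top , q≤n)) = ψ-intro q p constants constants-apart (constants-below (≤-reflexive top))
        where open Constants m>0 {q} (λ i → <-≤-trans (toℕ<n i) q≤n)

    ⊗⊨ρ⇔ : ⟨ n ⊗ 𝒯 m ,=⟩ ⊨ ρ q p ⇔ (suc p ≡ m × n ≡ q)
    ⊗⊨ρ⇔ = mk⇔ to from
      where
      matrix : Formula q
      matrix = apartNotD q p ∧ all (NotD< p zero ⇒ ⋁ q (λ i → zero ≐ suc (opposite i)))

      top : ∀ {e} → ⟦ matrix ⟧ e → suc p ≡ m
      top {e} (h , cover) with m≤n⇒m<n∨m≡n (nonempty⇒p<m {q} {p} {e} q>0 h)
      ... | inj₂ p+1≡m = p+1≡m
      -- One step sequence more than the `q` points that are supposed to exhaust the level.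
      ... | inj₁ p+1<m = ⊥-elim (1+n≰n (covered⇒≤ q p {e} steps
        (apart⇒distinct steps steps-apart) steps-below cover))
        where open Steps p+1<m n>0 (suc q)

      count : ∀ {e} → ⟦ matrix ⟧ e → n ≡ q
      count {e} h = ≤-antisym
        -- Here `constants` is indexed by `Fin n`, one point for each available head.
        (covered⇒≤ q p {e} constants (apart⇒distinct constants constants-apart)
          (constants-below (≤-reflexive (top {e} h))) (proj₂ h))
        (apartNotD⇒q≤n (top {e} h) {e} (proj₁ h))
        where open Constants m>0 toℕ<n

      to : ⟨ n ⊗ 𝒯 m ,=⟩ ⊨ ρ q p → suc p ≡ m × n ≡ q
      to h = rec ≡-irrelevant (λ (e , h) → top {e} h) (exs-elim _ q h) ,
             rec ≡-irrelevant (λ (e , h) → count {e} h) (exs-elim _ q h)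

      from : suc p ≡ m × n ≡ q → ⟨ n ⊗ 𝒯 m ,=⟩ ⊨ ρ q p
      from (p+1≡m , n≡q) = exs-intro _ q (tabulate constants)
        ( apartNotD-intro q p constants constants-apart (constants-below (≤-reflexive p+1≡m))
        -- Disjunct `i` mentions the variable `opposite i`, so the reversal is applied twice and
        -- cancels, leaving the constant with the same head as `z`.
        , λ z z-notD< → ⋁-intro _ q (opposite (index z)) (equal z (NotD<⇒Below p z-notD<)))
        where
        open Constants m>0 {q} (λ i → subst (toℕ i <_) (sym n≡q) (toℕ<n i))

        z0<q : (z : Carrier) → proj₁ z 0 < q
        z0<q z = subst (proj₁ z 0 <_) n≡q (head (proj₂ z))

        index : Carrier → Fin q
        index z = fromℕ< (z0<q z)

        equal : ∀ z → Below p z → z ≈ lookup (tabulate constants) (opposite (opposite (index z)))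
        equal z below k
          rewrite opposite-involutive (index z) | lookup∘tabulate constants (index z) = pointwise k
          where
          pointwise : z ≈ constants (index z)
          pointwise zero    = sym (toℕ-fromℕ< (z0<q z))
          pointwise (suc k) = Below-top⇒zero p+1≡m z below k

  -- With unbounded heads, points with zero tail already supply `q` apart elements at every nonempty
  -- level, the last one included.
  ω⊗⊨ψ⇔ : ContinuityPrinciple → (m p q : ℕ) → m > 0 → q > 0 → ⟨ ω⊗ 𝒯 m ,=⟩ ⊨ ψ q p ⇔ p < m
  ω⊗⊨ψ⇔ cp m p q m>0 q>0 = mk⇔
    (λ h → rec <-irrelevant (λ (e , h) → nonempty⇒p<m {q} {p} {e} q>0 h) (exs-elim _ q h))
    (λ p<m → ψ-intro q p constants constants-apart (constants-below p<m))
    where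
    open Counting cp (ω⊗-prefixed m)
    open Constants m>0 {q} (λ _ → tt)

theorem8p2 : (T : Truncation) → let open Intuitionistic T in
    ContinuityPrinciple →
    ((m n p q : ℕ) → m > 0 → n > 0 → p > 0 → q > 0 →
    ⟨ n ⊗ 𝒯 m ,=⟩ ⊨ ψ q p ⇔ (suc p < m ⊎ (suc p ≡ m × q ≤ n)))
    × ((m n p q : ℕ) → m > 0 → n > 0 → p > 0 → q > 0 →
    ⟨ n ⊗ 𝒯 m ,=⟩ ⊨ ρ q p ⇔ (suc p ≡ m × n ≡ q))
    × ((m p q : ℕ) → m > 0 → p > 0 → q > 0 →
    ⟨ ω⊗ 𝒯 m ,=⟩ ⊨ ψ q p ⇔ p < m)
theorem8p2 T cp =
  (λ m n p q m>0 n>0 _ q>0 → ⊗⊨ψ⇔ T cp m n p q m>0 n>0 q>0) ,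
  (λ m n p q m>0 n>0 _ q>0 → ⊗⊨ρ⇔ T cp m n p q m>0 n>0 q>0) ,
  (λ m p q m>0 _ q>0 → ω⊗⊨ψ⇔ T cp m p q m>0 q>0)
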